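{- For integers $0\le l\le m$ let $$A_{l,m}:=l!\,m!\,2^{m+l}d_{l,m}=\frac{l!\,m!}{2^{m-l}}\sum_{k=l}^{m}2^{k}\binom{2m-2k}{m-k}\binom{m+k}{k}\binom{k}{l}.$$ Then $A_{l,m}$ is a positive integer and $$\nu_{2}(A_{l,m})=\nu_{2}\big((m+1-l)_{2l}\big)+l,$$ where $(x)_k=x(x+1)\cdots(x+k-1)$ for $k\ge1$ and $(x)_0=1$. In particular $\nu_2(A_{1,m})=\nu_2(m(m+1))+1$.
   Context: $d_{l,m}=2^{ -2m}\sum_{k=l}^{m}2^{k}\binom{2m-2k}{m-k}\binom{m+k}{m}\binom{k}{l}$. For a nonzero rational $x$, $\nu_2(x)$ denotes its $2$-adic valuation (the exponent of $2$ in $x$). -}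

module Defs where

open import Data.Nat as ℕ using (ℕ; zero; suc; _+_; _∸_; _^_; _!)
open import Data.Nat.Combinatorics using (_C_)
open import Data.Nat.ListAction using (sum)
open import Data.Nat.Primality.Factorisation using (factorise; factors)
open import Data.Nat.Properties using (m^n≢0)
open import Data.Integer as ℤ using (ℤ; +_)
open import Data.List using (length; filter; map; upTo)
open import Data.Rational as ℚ using (ℚ; _/_; _*_)

∑[_⋯_] : ℕ → ℕ → (ℕ → ℕ) → ℕ
∑[ a ⋯ b ] f = sum (map (λ i → f (a + i)) (upTo (suc b ∸ a)))

infixl 7 _/2^_

_/2^_ : ℕ → ℕ → ℚ
n /2^ e = _/_ (+ n) (2 ^ e) {{m^n≢0 2 e}}

fromℕ : ℕ → ℚ
fromℕ n = + n / 1

d : ℕ → ℕ → ℚ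
d l m = 1 /2^ (2 ℕ.* m) * fromℕ
  (∑[ l ⋯ m ] λ k →
    2 ^ k ℕ.* ((2 ℕ.* m ∸ 2 ℕ.* k) C (m ∸ k)) ℕ.* ((m + k) C m) ℕ.* (k C l))

A : ℕ → ℕ → ℚ
A l m = fromℕ (l ! ℕ.* m ! ℕ.* 2 ^ (m + l)) * d l m

-- (x)ₖ = x (x + 1) ⋯ (x + k - 1)
pochhammer : ℕ → ℕ → ℕ
pochhammer x zero    = 1
pochhammer x (suc k) = pochhammer x k ℕ.* (x + k)

-- The multiplicity of 2 in the prime factorisation of n.
ν₂ℕ : (n : ℕ) → .{{ℕ.NonZero n}} → ℕ
ν₂ℕ n = length (filter (2 ℕ.≟_) (factors (factorise n)))

ν₂ : (x : ℚ) → .{{ℚ.NonZero x}} → ℤ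
ν₂ (ℚ.mkℚ n d-1 _) = + ν₂ℕ ℤ.∣ n ∣ ℤ.- + ν₂ℕ (suc d-1)

{-# OPTIONS --safe #-}

-- Write c_k = 2^k C(2m-2k, m-k) C(m+k, m), S_l = Σ_k c_k C(k, l) and N_l = l! m! S_l.
-- The generating polynomial Σ_l S_l a^l = Σ_k c_k (a+1)^k is a Jacobi polynomial, and its
-- differential equation (1 - a²) y″ - (2m + 1 + 2a) y′ + m (m + 1) y = 0 becomes, with
-- q_l = (m - l) (m + l + 1), the three-term recurrence
--   q_l N_l + N_{l+2} = (2m + 1) N_{l+1}.
-- Since (m + 1 - l)_{2l} = q_0 q_1 ⋯ q_{l-1}, writing N_l = 2^m (m + 1 - l)_{2l} B_l turns it into
--   B_l = (2m + 1) B_{l+1} - q_{l+1} B_{l+2},   B_m = 1.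
-- Each q_l is even because its two factors have odd sum, so every B_l is odd; and
-- A_{l,m} = N_l / 2^(m-l) = 2^l (m + 1 - l)_{2l} B_l.

module Submission where

open import Defs
open import Data.Integer as ℤ using (+_)
import Data.Integer.Properties as ℤ
open import Data.List using (_++_; filter; length; map; applyUpTo; upTo)
open import Data.List.Properties using (filter-++; filter-none; length-++; map-upTo; map-cong)
open import Data.List.Relation.Binary.Permutation.Propositional.Properties
  using (filter-↭; ↭-length)
import Data.List.Relation.Unary.All as All
import Data.List.Relation.Unary.All.Properties as All
open import Data.Nat as ℕ
  using (ℕ; zero; suc; _+_; _∸_; _^_; _!; _≤_; _<_; NonZero)
open import Data.Nat.Combinatorics
  using (_C_; nCk+nC[k+1]≡[n+1]C[k+1]; nC1≡n; nCn≡1; k>n⇒nCk≡0; nCk≡nC[n∸k];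
         nCk≡n!/k![n-k]!; k![n∸k]!∣n!)
open import Data.Nat.Divisibility
open import Data.Nat.DivMod using (m*[n/m]≡n)
open import Data.Nat.ListAction using (sum)
open import Data.Nat.ListAction.Properties using (product-++; ∈⇒∣product)
open import Data.Nat.Primality using (prime[2]; euclidsLemma)
open import Data.Nat.Primality.Factorisation
open import Data.Nat.Properties
open import Data.Nat.Tactic.RingSolver using (solve-∀)
open import Data.Product using (_×_; _,_; Σ-syntax; ∃-syntax)
open import Data.Rational as ℚ using (ℚ; _*_)
import Data.Rational.Properties as ℚ
open import Data.Rational.Unnormalised as ℚᵘ using (mkℚᵘ; *≡*)
import Data.Rational.Unnormalised.Properties as ℚᵘ
open import Data.Sum using ([_,_]′)
open import Relation.Binary.PropositionalEquality
open import Relation.Nullary using (¬_; contradiction)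

-- Binomial identities over ℕ

-- Linear combinations of equations over ℕ: a = b follows from c = d as soon as
-- a - b = c - d is a ring identity.
cancel-eq : ∀ {a b c d} → c ≡ d → a + d ≡ b + c → a ≡ b
cancel-eq {a} {b} {c} refl eq = +-cancelʳ-≡ c a b eq

-- This is (k+1) C(n, k+1) = (n-k) C(n, k) with the negative term moved across, so it needs no
-- truncated subtraction and holds for k > n too. Induction on `n` by Pascal's rule.
C-absorb : ∀ n k → suc k ℕ.* (n C suc k) + k ℕ.* (n C k) ≡ n ℕ.* (n C k)
C-absorb zero    zero    = refl
C-absorb zero    (suc k) = cong₂ _+_ (*-zeroʳ k) (*-zeroʳ k)
C-absorb (suc n) zero    rewrite nC1≡n (suc n) = solve n
  where
  solve : ∀ n → 1 ℕ.* suc n + 0 ≡ suc n ℕ.* 1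
  solve = solve-∀
C-absorb (suc n) (suc k)
  rewrite sym (nCk+nC[k+1]≡[n+1]C[k+1] n (suc k)) | sym (nCk+nC[k+1]≡[n+1]C[k+1] n k)
  = cancel-eq (cong₂ _+_ (C-absorb n k) (C-absorb n (suc k)))
      (solve n k (n C k) (n C suc k) (n C suc (suc k)))
  where
  solve : ∀ n k x y z →
    suc (suc k) ℕ.* (y + z) + suc k ℕ.* (x + y) + (n ℕ.* x + n ℕ.* y)
      ≡ suc n ℕ.* (x + y) + (suc k ℕ.* y + k ℕ.* x + (suc (suc k) ℕ.* z + suc k ℕ.* y))
  solve = solve-∀

C-row : ∀ n k → suc n ℕ.* (n C k) + k ℕ.* (suc n C k) ≡ suc n ℕ.* (suc n C k)
C-row n zero    = +-identityʳ _
C-row n (suc k) rewrite sym (nCk+nC[k+1]≡[n+1]C[k+1] n k)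
  = cancel-eq (C-absorb n k) (solve n k (n C k) (n C suc k))
  where
  solve : ∀ n k x y →
    suc n ℕ.* y + suc k ℕ.* (x + y) + n ℕ.* x
      ≡ suc n ℕ.* (x + y) + (suc k ℕ.* y + k ℕ.* x)
  solve = solve-∀

-- By Pascal's rule C(2j+2, j+1) is the sum of the two middle entries of row 2j+1. `C-absorb` says
-- that these are equal, and `C-row`, taken twice, compares them with C(2j, j).
C-central : ∀ j →
  suc j ℕ.* ((2 ℕ.* suc j) C suc j) ≡ 2 ℕ.* suc (2 ℕ.* j) ℕ.* ((2 ℕ.* j) C j)
C-central j
  rewrite +-suc j (j + 0) | sym (nCk+nC[k+1]≡[n+1]C[k+1] (suc (2 ℕ.* j)) j)
  = cancel-eq
      (cong₂ _+_ (cong (2 ℕ.*_) (sym (C-row (2 ℕ.* j) j))) (C-absorb (suc (2 ℕ.* j)) j))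
      (solve j ((2 ℕ.* j) C j) (suc (2 ℕ.* j) C j) (suc (2 ℕ.* j) C suc j))
  where
  solve : ∀ j a b c →
    suc j ℕ.* (b + c) + (2 ℕ.* (suc (2 ℕ.* j) ℕ.* a + j ℕ.* b) + suc (2 ℕ.* j) ℕ.* b)
      ≡ 2 ℕ.* suc (2 ℕ.* j) ℕ.* a + (2 ℕ.* (suc (2 ℕ.* j) ℕ.* b) + (suc j ℕ.* c + j ℕ.* b))
  solve = solve-∀

-- The coefficients c_k and their ratio

coeff : ℕ → ℕ → ℕ
coeff m k = 2 ^ k ℕ.* ((2 ℕ.* m ∸ 2 ℕ.* k) C (m ∸ k)) ℕ.* ((m + k) C m)

coeff-≡ : ∀ {m} k j → k + j ≡ m →
  coeff m k ≡ 2 ^ k ℕ.* ((2 ℕ.* j) C j) ℕ.* ((m + k) C m)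
coeff-≡ k j refl
  rewrite sym (*-distribˡ-∸ 2 (k + j) k) | m+n∸m≡n k j
  = refl

-- With j + 1 = m - k, this is the ratio c_(k+1) / c_k. The extra factor 2 of the power cancels the
-- 2 in `C-central`, and `C-row` gives (m+k+1) C(m+k, m) = (k+1) C(m+k+1, m). The telescoping in
-- `S-partial` rests on it.
coeff-suc : ∀ {m} k j → k + suc j ≡ m →
  suc (2 ℕ.* j) ℕ.* suc k ℕ.* coeff m (suc k) ≡ suc j ℕ.* suc (m + k) ℕ.* coeff m k
coeff-suc {m} k j eq
  rewrite coeff-≡ k (suc j) eq | coeff-≡ (suc k) j (trans (sym (+-suc k j)) eq) | +-suc m k
  = cancel-eq
      (cong₂ _+_
        (cong (2 ^ k ℕ.* ((2 ℕ.* suc j) C suc j) ℕ.* suc j ℕ.*_) (sym (C-row (m + k) m)))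
        (cong (2 ^ k ℕ.* suc k ℕ.* (suc (m + k) C m) ℕ.*_) (sym (C-central j))))
      (solve m k j (2 ^ k) ((2 ℕ.* suc j) C suc j) ((2 ℕ.* j) C j) ((m + k) C m) (suc (m + k) C m))
  where
  solve : ∀ m k j p a b x y →
    suc (2 ℕ.* j) ℕ.* suc k ℕ.* (2 ℕ.* p ℕ.* b ℕ.* y)
      + (p ℕ.* a ℕ.* suc j ℕ.* (suc (m + k) ℕ.* x + m ℕ.* y)
         + p ℕ.* suc k ℕ.* y ℕ.* (suc j ℕ.* a))
    ≡ suc j ℕ.* suc (m + k) ℕ.* (p ℕ.* a ℕ.* x)
      + (p ℕ.* a ℕ.* suc j ℕ.* (suc (m + k) ℕ.* y)
         + p ℕ.* suc k ℕ.* y ℕ.* (2 ℕ.* suc (2 ℕ.* j) ℕ.* b))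
  solve = solve-∀

-- The differential equation, coefficient by coefficient

∑< : ℕ → (ℕ → ℕ) → ℕ
∑< zero    f = 0
∑< (suc n) f = ∑< n f + f n

-- The sum starts at k = 0 rather than at `l`, so that the sums for `l`, `l + 1` and `l + 2` have
-- one range. The full sum S_l is the case `n = suc m`.
S : ℕ → ℕ → ℕ → ℕ
S m n l = ∑< n (λ k → coeff m k ℕ.* (k C l))

-- The coefficient of a^l in the operator of the differential equation applied to (a + 1)^n, which is
-- j (m + n + 1) (a + 1)^n - n (2j + 1) (a + 1)^(n-1); negative terms are moved across.
C-operator : ∀ {m} l n j → n + j ≡ m →
  m ℕ.* suc m ℕ.* (n C l) + suc l ℕ.* suc (suc l) ℕ.* (n C suc (suc l))
    + suc (2 ℕ.* j) ℕ.* (suc l ℕ.* (n C suc l))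
  ≡ suc (2 ℕ.* m) ℕ.* suc l ℕ.* (n C suc l) + l ℕ.* suc l ℕ.* (n C l)
    + j ℕ.* suc (m + n) ℕ.* (n C l)
C-operator l n j refl =
  cancel-eq
    (cong₂ _+_
      (cong (suc (n + l) ℕ.*_) (sym (C-absorb n l)))
      (cong (suc l ℕ.*_) (C-absorb n (suc l))))
    (solve l n j (n C l) (n C suc l) (n C suc (suc l)))
  where
  solve : ∀ l n j x y z →
    (n + j) ℕ.* suc (n + j) ℕ.* x + suc l ℕ.* suc (suc l) ℕ.* z
      + suc (2 ℕ.* j) ℕ.* (suc l ℕ.* y)
      + (suc (n + l) ℕ.* (suc l ℕ.* y + l ℕ.* x) + suc l ℕ.* (n ℕ.* y))
    ≡ suc (2 ℕ.* (n + j)) ℕ.* suc l ℕ.* y + l ℕ.* suc l ℕ.* x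
      + j ℕ.* suc (n + j + n) ℕ.* x
      + (suc (n + l) ℕ.* (n ℕ.* x) + suc l ℕ.* (suc (suc l) ℕ.* z + suc l ℕ.* y))
  solve = solve-∀

suc-C-suc : ∀ n l → suc l ℕ.* (suc n C suc l) ≡ suc n ℕ.* (n C l)
suc-C-suc n l rewrite sym (nCk+nC[k+1]≡[n+1]C[k+1] n l) =
  cancel-eq (C-absorb n l) (solve n l (n C l) (n C suc l))
  where
  solve : ∀ n l x y → suc l ℕ.* (x + y) + n ℕ.* x ≡ suc n ℕ.* x + (suc l ℕ.* y + l ℕ.* x)
  solve = solve-∀

-- Adding c_n times `C-operator` cancels the old remainder and leaves the term in (a + 1)^n. That
-- term is a variable `t`, so that it can be rewritten as the next remainder when n < m and reduced
-- to 0 when n = m.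
S-partial-step : ∀ {m} l n j → n + j ≡ m → ∀ {t} →
  m ℕ.* suc m ℕ.* S m n l + suc l ℕ.* suc (suc l) ℕ.* S m n (suc (suc l))
    ≡ suc (2 ℕ.* m) ℕ.* suc l ℕ.* S m n (suc l) + l ℕ.* suc l ℕ.* S m n l
      + suc (2 ℕ.* j) ℕ.* coeff m n ℕ.* (suc l ℕ.* (n C suc l)) →
  t ≡ j ℕ.* suc (m + n) ℕ.* coeff m n ℕ.* (n C l) →
  m ℕ.* suc m ℕ.* S m (suc n) l + suc l ℕ.* suc (suc l) ℕ.* S m (suc n) (suc (suc l))
    ≡ suc (2 ℕ.* m) ℕ.* suc l ℕ.* S m (suc n) (suc l) + l ℕ.* suc l ℕ.* S m (suc n) l + t
S-partial-step {m} l n j eq ih refl =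
  cancel-eq (cong₂ _+_ ih (cong (coeff m n ℕ.*_) (C-operator l n j eq)))
    (solve m l n j (S m n l) (S m n (suc l)) (S m n (suc (suc l)))
      (coeff m n) (n C l) (n C suc l) (n C suc (suc l)))
  where
  solve : ∀ m l n j s s′ s″ c x y z →
    m ℕ.* suc m ℕ.* (s + c ℕ.* x) + suc l ℕ.* suc (suc l) ℕ.* (s″ + c ℕ.* z)
      + (suc (2 ℕ.* m) ℕ.* suc l ℕ.* s′ + l ℕ.* suc l ℕ.* s
           + suc (2 ℕ.* j) ℕ.* c ℕ.* (suc l ℕ.* y)
         + c ℕ.* (suc (2 ℕ.* m) ℕ.* suc l ℕ.* y + l ℕ.* suc l ℕ.* x
           + j ℕ.* suc (m + n) ℕ.* x))
    ≡ suc (2 ℕ.* m) ℕ.* suc l ℕ.* (s′ + c ℕ.* y) + l ℕ.* suc l ℕ.* (s + c ℕ.* x)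
      + j ℕ.* suc (m + n) ℕ.* c ℕ.* x
      + (m ℕ.* suc m ℕ.* s + suc l ℕ.* suc (suc l) ℕ.* s″
         + c ℕ.* (m ℕ.* suc m ℕ.* x + suc l ℕ.* suc (suc l) ℕ.* z
           + suc (2 ℕ.* j) ℕ.* (suc l ℕ.* y)))
  solve = solve-∀

-- Summed against c_k, the images of the powers (a + 1)^k telescope: the last summand is what
-- remains after k < n.
S-partial : ∀ {m} l n j → n + j ≡ m →
  m ℕ.* suc m ℕ.* S m n l + suc l ℕ.* suc (suc l) ℕ.* S m n (suc (suc l))
    ≡ suc (2 ℕ.* m) ℕ.* suc l ℕ.* S m n (suc l) + l ℕ.* suc l ℕ.* S m n l
      + suc (2 ℕ.* j) ℕ.* coeff m n ℕ.* (suc l ℕ.* (n C suc l))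
S-partial {m} l zero j eq = solve m l j (coeff m 0)
  where
  solve : ∀ m l j c →
    m ℕ.* suc m ℕ.* 0 + suc l ℕ.* suc (suc l) ℕ.* 0
      ≡ suc (2 ℕ.* m) ℕ.* suc l ℕ.* 0 + l ℕ.* suc l ℕ.* 0 + suc (2 ℕ.* j) ℕ.* c ℕ.* (suc l ℕ.* 0)
  solve = solve-∀
S-partial {m} l (suc n) j eq =
  S-partial-step l n (suc j) eq′ (S-partial l n (suc j) eq′) (begin
    suc (2 ℕ.* j) ℕ.* coeff m (suc n) ℕ.* (suc l ℕ.* (suc n C suc l))
      ≡⟨ cong (suc (2 ℕ.* j) ℕ.* coeff m (suc n) ℕ.*_) (suc-C-suc n l) ⟩
    suc (2 ℕ.* j) ℕ.* coeff m (suc n) ℕ.* (suc n ℕ.* (n C l))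
      ≡⟨ solve (suc (2 ℕ.* j)) (coeff m (suc n)) (suc n) (n C l) ⟩
    suc (2 ℕ.* j) ℕ.* suc n ℕ.* coeff m (suc n) ℕ.* (n C l)
      -- The lower-order term of (a + 1)^(n+1) matches the leading term of (a + 1)^n exactly because
      -- of the ratio of consecutive coefficients.
      ≡⟨ cong (ℕ._* (n C l)) (coeff-suc n j eq′) ⟩
    suc j ℕ.* suc (m + n) ℕ.* coeff m n ℕ.* (n C l) ∎)
  where
  open ≡-Reasoning
  eq′ = trans (+-suc n j) eq
  solve : ∀ a b c d → a ℕ.* b ℕ.* (c ℕ.* d) ≡ a ℕ.* c ℕ.* b ℕ.* d
  solve = solve-∀

∑<-zero : ∀ n {f} → (∀ {k} → k < n → f k ≡ 0) → ∑< n f ≡ 0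
∑<-zero zero    f≡0 = refl
∑<-zero (suc n) f≡0 = cong₂ _+_ (∑<-zero n (λ k<n → f≡0 (m<n⇒m<1+n k<n))) (f≡0 ≤-refl)

S-vanish : ∀ m {n l} → n ≤ l → S m n l ≡ 0
S-vanish m {n} n≤l = ∑<-zero n λ {k} k<n →
  trans (cong (coeff m k ℕ.*_) (k>n⇒nCk≡0 (<-≤-trans k<n n≤l))) (*-zeroʳ (coeff m k))

-- At n = m the remainder has the factor j = 0 and disappears. The coefficient of S_l is then m(m+1)
-- - l(l+1) = (m-l)(m+l+1).
S-recurrence : ∀ {m} l t → l + t ≡ m →
  t ℕ.* suc (m + l) ℕ.* S m (suc m) l + suc l ℕ.* suc (suc l) ℕ.* S m (suc m) (suc (suc l))
    ≡ suc (2 ℕ.* m) ℕ.* suc l ℕ.* S m (suc m) (suc l)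
S-recurrence {m} l t refl =
  cancel-eq
    (S-partial-step l m 0 (+-identityʳ m) (S-partial l m 0 (+-identityʳ m)) refl)
    (solve l t (S m (suc m) l) (S m (suc m) (suc l)) (S m (suc m) (suc (suc l))))
  where
  solve : ∀ l t s s′ s″ →
    t ℕ.* suc (l + t + l) ℕ.* s + suc l ℕ.* suc (suc l) ℕ.* s″
      + (suc (2 ℕ.* (l + t)) ℕ.* suc l ℕ.* s′ + l ℕ.* suc l ℕ.* s + 0)
    ≡ suc (2 ℕ.* (l + t)) ℕ.* suc l ℕ.* s′
      + ((l + t) ℕ.* suc (l + t) ℕ.* s + suc l ℕ.* suc (suc l) ℕ.* s″)
  solve = solve-∀

N : ℕ → ℕ → ℕ
N m l = l ! ℕ.* m ! ℕ.* S m (suc m) l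

-- The factor l! m! absorbs (l+1)(l+2) into (l+2)! and (l+1) into (l+1)!.
N-recurrence : ∀ {m} l t → l + t ≡ m →
  t ℕ.* suc (m + l) ℕ.* N m l + N m (suc (suc l)) ≡ suc (2 ℕ.* m) ℕ.* N m (suc l)
N-recurrence {m} l t eq =
  cancel-eq (cong (l ! ℕ.* m ! ℕ.*_) (S-recurrence l t eq))
    (solve m l t (l !) (m !) (S m (suc m) l) (S m (suc m) (suc l)) (S m (suc m) (suc (suc l))))
  where
  solve : ∀ m l t a b s s′ s″ →
    t ℕ.* suc (m + l) ℕ.* (a ℕ.* b ℕ.* s) + suc (suc l) ℕ.* (suc l ℕ.* a) ℕ.* b ℕ.* s″
      + a ℕ.* b ℕ.* (suc (2 ℕ.* m) ℕ.* suc l ℕ.* s′)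
    ≡ suc (2 ℕ.* m) ℕ.* (suc l ℕ.* a ℕ.* b ℕ.* s′)
      + a ℕ.* b ℕ.* (t ℕ.* suc (m + l) ℕ.* s + suc l ℕ.* suc (suc l) ℕ.* s″)
  solve = solve-∀

-- The products of the q_l as quotients of factorials

-- R m l = (m + 1 - l)₂ₗ for l ≤ m; the value R m (m + 1) = 0 starts the descending recurrence.
R : ℕ → ℕ → ℕ
R m zero    = 1
R m (suc l) = (m ∸ l) ℕ.* suc (m + l) ℕ.* R m l

l+t≡m⇒m∸l≡t : ∀ {m} l t → l + t ≡ m → m ∸ l ≡ t
l+t≡m⇒m∸l≡t l t refl = m+n∸m≡n l t

-- Each new factor of `R` extends the product at both ends: `m ∸ l` completes the factorial on the
-- left, `suc (m + l)` the one on the right. Hence `R m l` is (m+l)! / (m-l)!.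
R-! : ∀ {m} l t → l + t ≡ m → R m l ℕ.* t ! ≡ (m + l) !
R-! {m} zero t refl rewrite +-identityʳ m = *-identityˡ (m !)
R-! {m} (suc l) t eq
  rewrite l+t≡m⇒m∸l≡t l (suc t) (trans (+-suc l t) eq) | +-suc m l
        | sym (R-! l (suc t) (trans (+-suc l t) eq))
  = solve (suc t) (suc (m + l)) (R m l) (t !)
  where
  solve : ∀ a b r f → a ℕ.* b ℕ.* r ℕ.* f ≡ b ℕ.* (r ℕ.* (a ℕ.* f))
  solve = solve-∀

R≢0 : ∀ {m} l t → l + t ≡ m → NonZero (R m l)
R≢0 {m} l t eq = m*n≢0⇒m≢0 (R m l) {t !} {{subst NonZero (sym (R-! l t eq)) ((m + l) !≢0)}}

pochhammer-! : ∀ n k → pochhammer (suc n) k ℕ.* n ! ≡ (n + k) !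
pochhammer-! n zero rewrite +-identityʳ n = *-identityˡ (n !)
pochhammer-! n (suc k) rewrite +-suc n k | sym (pochhammer-! n k) =
  solve (pochhammer (suc n) k) (suc (n + k)) (n !)
  where
  solve : ∀ p a f → p ℕ.* a ℕ.* f ≡ a ℕ.* (p ℕ.* f)
  solve = solve-∀

-- `R` grows from the middle outwards and `pochhammer` from the lower end upwards; multiplied by
-- `t !`, both become (m+l)!.
R≡pochhammer : ∀ {m} l t → l + t ≡ m → R m l ≡ pochhammer (m + 1 ∸ l) (2 ℕ.* l)
R≡pochhammer l t refl = *-cancelʳ-≡ _ _ (t !) {{t !≢0}} (begin
  R (l + t) l ℕ.* t !                              ≡⟨ R-! l t refl ⟩
  (l + t + l) !                                    ≡⟨ cong _! (rearrange l t) ⟩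
  (t + 2 ℕ.* l) !                                  ≡⟨ pochhammer-! t (2 ℕ.* l) ⟨
  pochhammer (suc t) (2 ℕ.* l) ℕ.* t !             ≡⟨ cong (λ x → pochhammer x (2 ℕ.* l) ℕ.* t !) shift ⟨
  pochhammer (l + t + 1 ∸ l) (2 ℕ.* l) ℕ.* t !     ∎)
  where
  open ≡-Reasoning
  rearrange : ∀ l t → l + t + l ≡ t + 2 ℕ.* l
  rearrange = solve-∀
  shift : l + t + 1 ∸ l ≡ suc t
  shift = trans (cong (_∸ l) (+-assoc l t 1)) (trans (m+n∸m≡n l (t + 1)) (+-comm t 1))

centralC-! : ∀ m → m ! ℕ.* m ! ℕ.* ((m + m) C m) ≡ (m + m) !
centralC-! m = begin
  m ! ℕ.* m ! ℕ.* ((m + m) C m)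
    ≡⟨ cong (λ x → m ! ℕ.* x ! ℕ.* ((m + m) C m)) (m+n∸m≡n m m) ⟨
  m ! ℕ.* (m + m ∸ m) ! ℕ.* ((m + m) C m)
    ≡⟨ cong (m ! ℕ.* (m + m ∸ m) ! ℕ.*_) (nCk≡n!/k![n-k]! (m≤m+n m m)) ⟩
  m ! ℕ.* (m + m ∸ m) ! ℕ.* ((m + m) ! ℕ./ (m ! ℕ.* (m + m ∸ m) !))
    ≡⟨ m*[n/m]≡n (k![n∸k]!∣n! (m≤m+n m m)) ⟩
  (m + m) ! ∎
  where
  open ≡-Reasoning
  instance _ = m !* (m + m ∸ m) !≢0

-- Oddness of B_l by descending recurrence

OddMultiple : ℕ → ℕ → Set
OddMultiple w n = ∃[ b ] (¬ 2 ∣ b × n ≡ w ℕ.* b)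

2∤1 : ¬ 2 ∣ 1
2∤1 2∣1 with () ← ∣1⇒≡1 2∣1

-- Cancelling the nonzero `w` gives `y ≤ x`, so `x ∸ y` is a true difference, odd as odd minus even.
oddMultiple-∸ : ∀ w {n x y} .{{_ : NonZero w}} →
  n + w ℕ.* y ≡ w ℕ.* x → 2 ∣ y → ¬ 2 ∣ x → OddMultiple w n
oddMultiple-∸ w {n} {x} {y} eq 2∣y 2∤x =
  x ∸ y ,
  (λ 2∣x∸y → 2∤x (subst (2 ∣_) (m∸n+n≡m y≤x) (∣m∣n⇒∣m+n 2∣x∸y 2∣y))) ,
  +-cancelʳ-≡ (w ℕ.* y) _ _ (begin
    n + w ℕ.* y                  ≡⟨ eq ⟩
    w ℕ.* x                      ≡⟨ cong (w ℕ.*_) (m∸n+n≡m y≤x) ⟨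
    w ℕ.* (x ∸ y + y)            ≡⟨ *-distribˡ-+ w (x ∸ y) y ⟩
    w ℕ.* (x ∸ y) + w ℕ.* y      ∎)
  where
  open ≡-Reasoning
  y≤x : y ≤ x
  y≤x = *-cancelˡ-≤ w (subst (w ℕ.* y ≤_) eq (m≤n+m (w ℕ.* y) n))

2∣n*[1+n] : ∀ n → 2 ∣ n ℕ.* suc n
2∣n*[1+n] zero    = 2 ∣0
2∣n*[1+n] (suc n) = subst (2 ∣_) (solve n) (∣m∣n⇒∣m+n (2∣n*[1+n] n) (m∣m*n {2} (suc n)))
  where
  solve : ∀ n → n ℕ.* suc n + 2 ℕ.* suc n ≡ suc n ℕ.* suc (suc n)
  solve = solve-∀

-- The product is t(t+1) + 2tl.
2∣t*[1+m+l] : ∀ {m} l t → l + t ≡ m → 2 ∣ t ℕ.* suc (m + l)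
2∣t*[1+m+l] l t refl =
  subst (2 ∣_) (solve l t) (∣m∣n⇒∣m+n (2∣n*[1+n] t) (m∣m*n {2} (t ℕ.* l)))
  where
  solve : ∀ l t → t ℕ.* suc t + 2 ℕ.* (t ℕ.* l) ≡ t ℕ.* suc (l + t + l)
  solve = solve-∀

2∤1+2n : ∀ n → ¬ 2 ∣ suc (2 ℕ.* n)
2∤1+2n n 2∣ = 2∤1 (∣m+n∣m⇒∣n (subst (2 ∣_) (+-comm 1 (2 ℕ.* n)) 2∣) (m∣m*n {2} n))

2∤* : ∀ a b → ¬ 2 ∣ a → ¬ 2 ∣ b → ¬ 2 ∣ a ℕ.* b
2∤* a b 2∤a 2∤b 2∣ab = [ 2∤a , 2∤b ]′ (euclidsLemma a b prime[2] 2∣ab)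

-- Only the summand k = m survives, and m! m! C(2m, m) = (2m)! = `R m m`; hence B_m = 1.
N-oddMultiple-top : ∀ m → OddMultiple (2 ^ m ℕ.* R m m) (N m m)
N-oddMultiple-top m = 1 , 2∤1 , (begin
  m ! ℕ.* m ! ℕ.* (S m m m + coeff m m ℕ.* (m C m))
    ≡⟨ cong (m ! ℕ.* m ! ℕ.*_) (cong₂ _+_ (S-vanish m {m} ≤-refl)
         (cong₂ ℕ._*_ (coeff-≡ m 0 (+-identityʳ m)) (nCn≡1 m))) ⟩
  m ! ℕ.* m ! ℕ.* (0 + 2 ^ m ℕ.* 1 ℕ.* ((m + m) C m) ℕ.* 1)
    ≡⟨ solve (m ! ℕ.* m !) (2 ^ m) ((m + m) C m) ⟩
  2 ^ m ℕ.* (m ! ℕ.* m ! ℕ.* ((m + m) C m))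
    ≡⟨ cong (2 ^ m ℕ.*_) (trans (centralC-! m) (sym (R-! m 0 (+-identityʳ m)))) ⟩
  2 ^ m ℕ.* (R m m ℕ.* 1)
    ≡⟨ *-assoc (2 ^ m) (R m m) 1 ⟨
  2 ^ m ℕ.* R m m ℕ.* 1 ∎)
  where
  open ≡-Reasoning
  solve : ∀ f p c → f ℕ.* (0 + p ℕ.* 1 ℕ.* c ℕ.* 1) ≡ p ℕ.* (f ℕ.* c)
  solve = solve-∀

-- Both sides are 0: the sum is empty of nonzero terms, and `R m (suc m)` contains `m ∸ m`. Any odd
-- witness serves, and 1 is chosen.
N-oddMultiple-beyond : ∀ m → OddMultiple (2 ^ m ℕ.* R m (suc m)) (N m (suc m))
N-oddMultiple-beyond m = 1 , 2∤1 , (begin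
  suc m ! ℕ.* m ! ℕ.* S m (suc m) (suc m)
    ≡⟨ cong (suc m ! ℕ.* m ! ℕ.*_) (S-vanish m {suc m} ≤-refl) ⟩
  suc m ! ℕ.* m ! ℕ.* 0
    ≡⟨ solve (suc m ! ℕ.* m !) (2 ^ m) ((suc (m + m))) (R m m) ⟩
  2 ^ m ℕ.* (0 ℕ.* suc (m + m) ℕ.* R m m) ℕ.* 1
    ≡⟨ cong (λ x → 2 ^ m ℕ.* (x ℕ.* suc (m + m) ℕ.* R m m) ℕ.* 1) (n∸n≡0 m) ⟨
  2 ^ m ℕ.* R m (suc m) ℕ.* 1 ∎)
  where
  open ≡-Reasoning
  solve : ∀ f p a r → f ℕ.* 0 ≡ p ℕ.* (0 ℕ.* a ℕ.* r) ℕ.* 1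
  solve = solve-∀

N-oddMultiple-step : ∀ {m} l t → l + suc t ≡ m →
  OddMultiple (2 ^ m ℕ.* R m (suc l)) (N m (suc l)) →
  OddMultiple (2 ^ m ℕ.* R m (suc (suc l))) (N m (suc (suc l))) →
  OddMultiple (2 ^ m ℕ.* R m l) (N m l)
N-oddMultiple-step {m} l t eq (b , 2∤b , Nb) (b′ , _ , Nb′) =
  oddMultiple-∸ w {{m*n≢0 (2 ^ m) (R m l) {{m^n≢0 2 m}} {{R≢0 l (suc t) eq}}}}
    -- The recurrence determines `q ℕ.* N m l`. Since `R m (suc l)` is `q` times `R m l`, every term
    -- carries `q`, which is positive because its first factor is `suc t`.
    (*-cancelˡ-≡ _ _ q (begin
      q ℕ.* (N m l + w ℕ.* (q′ ℕ.* b′))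
        ≡⟨ lhs q (N m l) (2 ^ m) (R m l) q′ b′ ⟩
      q ℕ.* N m l + 2 ^ m ℕ.* (q′ ℕ.* (q ℕ.* R m l)) ℕ.* b′
        ≡⟨ cong (λ x → q ℕ.* N m l + x) (trans Nb′ (cong₂
             (λ x y → 2 ^ m ℕ.* (x ℕ.* suc (m + suc l) ℕ.* (y ℕ.* suc (m + l) ℕ.* R m l)) ℕ.* b′)
             e′ e)) ⟨
      q ℕ.* N m l + N m (suc (suc l))
        ≡⟨ N-recurrence l (suc t) eq ⟩
      suc (2 ℕ.* m) ℕ.* N m (suc l)
        ≡⟨ cong (suc (2 ℕ.* m) ℕ.*_) (trans Nb (cong
             (λ y → 2 ^ m ℕ.* (y ℕ.* suc (m + l) ℕ.* R m l) ℕ.* b) e)) ⟩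
      suc (2 ℕ.* m) ℕ.* (2 ^ m ℕ.* (q ℕ.* R m l) ℕ.* b)
        ≡⟨ rhs q (suc (2 ℕ.* m)) (2 ^ m) (R m l) b ⟩
      q ℕ.* (w ℕ.* (suc (2 ℕ.* m) ℕ.* b)) ∎))
    (∣m⇒∣m*n b′ (2∣t*[1+m+l] (suc l) t eq″))
    (2∤* (suc (2 ℕ.* m)) b (2∤1+2n m) 2∤b)
  where
  open ≡-Reasoning
  w  = 2 ^ m ℕ.* R m l
  q  = suc t ℕ.* suc (m + l)
  q′ = t ℕ.* suc (m + suc l)
  eq″ = trans (sym (+-suc l t)) eq
  e  = l+t≡m⇒m∸l≡t l (suc t) eq
  e′ = l+t≡m⇒m∸l≡t (suc l) t eq″
  lhs : ∀ q n p r q′ b → q ℕ.* (n + p ℕ.* r ℕ.* (q′ ℕ.* b)) ≡ q ℕ.* n + p ℕ.* (q′ ℕ.* (q ℕ.* r)) ℕ.* b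
  lhs = solve-∀
  rhs : ∀ q a p r b → a ℕ.* (p ℕ.* (q ℕ.* r) ℕ.* b) ≡ q ℕ.* (p ℕ.* r ℕ.* (a ℕ.* b))
  rhs = solve-∀

-- Descending induction on `l`, run on `t`, which is m - l; two consecutive values are carried
-- because the recurrence has order two.
N-oddMultiple : ∀ {m} l t → l + t ≡ m →
  OddMultiple (2 ^ m ℕ.* R m l) (N m l) × OddMultiple (2 ^ m ℕ.* R m (suc l)) (N m (suc l))
N-oddMultiple {m} l zero eq with refl ← trans (sym (+-identityʳ l)) eq =
  N-oddMultiple-top m , N-oddMultiple-beyond m
N-oddMultiple l (suc t) eq with ih , ih′ ← N-oddMultiple (suc l) t (trans (sym (+-suc l t)) eq) =
  N-oddMultiple-step l t eq ih ih′ , ih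

-- From list sums to sums over an initial segment

-- `applyUpTo` shifts its function at each step, so `g` is kept apart from `f` and tied to it by the
-- current offset `a`.
∑<-+ : ∀ a n {f g} → (∀ i → g i ≡ f (a + i)) → ∑< a f + sum (applyUpTo g n) ≡ ∑< (a + n) f
∑<-+ a zero    {f} g≡f = trans (+-identityʳ (∑< a f)) (cong (λ b → ∑< b f) (sym (+-identityʳ a)))
∑<-+ a (suc n) {f} {g} g≡f = begin
  ∑< a f + (g 0 + sum (applyUpTo (λ i → g (suc i)) n))
    ≡⟨ +-assoc (∑< a f) (g 0) _ ⟨
  ∑< a f + g 0 + sum (applyUpTo (λ i → g (suc i)) n)
    ≡⟨ cong (λ x → ∑< a f + x + _) (trans (g≡f 0) (cong f (+-identityʳ a))) ⟩
  ∑< (suc a) f + sum (applyUpTo (λ i → g (suc i)) n)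
    ≡⟨ ∑<-+ (suc a) n (λ i → trans (g≡f (suc i)) (cong f (+-suc a i))) ⟩
  ∑< (suc a + n) f
    ≡⟨ cong (λ b → ∑< b f) (+-suc a n) ⟨
  ∑< (a + suc n) f ∎
  where open ≡-Reasoning

∑≡∑< : ∀ {l m f} → l ≤ m → (∀ {k} → k < l → f k ≡ 0) → ∑[ l ⋯ m ] f ≡ ∑< (suc m) f
∑≡∑< {l} {m} {f} l≤m f≡0 = begin
  sum (map (λ i → f (l + i)) (upTo (suc m ∸ l)))
    ≡⟨ cong sum (map-upTo (λ i → f (l + i)) (suc m ∸ l)) ⟩
  sum (applyUpTo (λ i → f (l + i)) (suc m ∸ l))
    ≡⟨ cong (λ x → x + sum (applyUpTo (λ i → f (l + i)) (suc m ∸ l))) (∑<-zero l f≡0) ⟨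
  ∑< l f + sum (applyUpTo (λ i → f (l + i)) (suc m ∸ l))
    ≡⟨ ∑<-+ l (suc m ∸ l) (λ _ → refl) ⟩
  ∑< (l + (suc m ∸ l)) f
    ≡⟨ cong (λ b → ∑< b f) (m+[n∸m]≡n (m≤n⇒m≤1+n l≤m)) ⟩
  ∑< (suc m) f ∎
  where open ≡-Reasoning

∑≡S : ∀ {l m} → l ≤ m → ∑[ l ⋯ m ] (λ k → coeff m k ℕ.* (k C l)) ≡ S m (suc m) l
∑≡S {l} {m} l≤m = ∑≡∑< l≤m λ {k} k<l →
  trans (cong (coeff m k ℕ.*_) (k>n⇒nCk≡0 k<l)) (*-zeroʳ (coeff m k))

-- Fractions with powers of 2, and the integrality of A

-- Passing to unnormalised rationals, where equality is cross-multiplication, avoids reasoning about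
-- reduced forms.
/-cross : ∀ a b m n .{{_ : NonZero m}} .{{_ : NonZero n}} →
  a ℕ.* n ≡ b ℕ.* m → + a ℚ./ m ≡ + b ℚ./ n
/-cross a b (suc m) (suc n) eq = ℚ.fromℚᵘ-cong {mkℚᵘ (+ a) m} {mkℚᵘ (+ b) n}
  (*≡* (trans (sym (ℤ.pos-* a (suc n))) (trans (cong +_ eq) (ℤ.pos-* b (suc m)))))

/-*-/ : ∀ a b m n .{{_ : NonZero m}} .{{_ : NonZero n}} .{{_ : NonZero (m ℕ.* n)}} →
  (+ a ℚ./ m) * (+ b ℚ./ n) ≡ + (a ℕ.* b) ℚ./ (m ℕ.* n)
/-*-/ a b (suc m) (suc n) = ℚ.toℚᵘ-injective (begin
  ℚ.toℚᵘ (ℚ.fromℚᵘ p * ℚ.fromℚᵘ q)                 ≈⟨ ℚ.toℚᵘ-homo-* (ℚ.fromℚᵘ p) (ℚ.fromℚᵘ q) ⟩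
  ℚ.toℚᵘ (ℚ.fromℚᵘ p) ℚᵘ.* ℚ.toℚᵘ (ℚ.fromℚᵘ q)     ≈⟨ ℚᵘ.*-cong (ℚ.toℚᵘ-fromℚᵘ p) (ℚ.toℚᵘ-fromℚᵘ q) ⟩
  p ℚᵘ.* q                                         ≡⟨ cong (λ z → mkℚᵘ z (n + m ℕ.* suc n)) (sym (ℤ.pos-* a b)) ⟩
  mkℚᵘ (+ (a ℕ.* b)) (n + m ℕ.* suc n)             ≈⟨ ℚ.toℚᵘ-fromℚᵘ _ ⟨
  ℚ.toℚᵘ (+ (a ℕ.* b) ℚ./ (suc m ℕ.* suc n))       ∎)
  where
  open ℚᵘ.≃-Reasoning
  p = mkℚᵘ (+ a) m
  q = mkℚᵘ (+ b) n

/2^-cross : ∀ a b e f → a ℕ.* 2 ^ f ≡ b ℕ.* 2 ^ e → a /2^ e ≡ b /2^ f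
/2^-cross a b e f = /-cross a b (2 ^ e) (2 ^ f) {{m^n≢0 2 e}} {{m^n≢0 2 f}}

/2^≡fromℕ : ∀ a b e → a ≡ b ℕ.* 2 ^ e → a /2^ e ≡ fromℕ b
/2^≡fromℕ a b e eq = /2^-cross a b e 0 (trans (*-identityʳ a) eq)

/2^-*-fromℕ : ∀ a b e → a /2^ e * fromℕ b ≡ (a ℕ.* b) /2^ e
/2^-*-fromℕ a b e = trans
  (/-*-/ a b (2 ^ e) 1 {{2^e≢0}} {{_}} {{m*n≢0 (2 ^ e) 1 {{2^e≢0}}}})
  (/-cross (a ℕ.* b) (a ℕ.* b) (2 ^ e ℕ.* 1) (2 ^ e) {{m*n≢0 (2 ^ e) 1 {{2^e≢0}}}} {{2^e≢0}}
    (cong (a ℕ.* b ℕ.*_) (sym (*-identityʳ (2 ^ e)))))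
  where
  2^e≢0 = m^n≢0 2 e

-- The powers combine by 2m - (m+l) = m - l.
A≡N/2^[m∸l] : ∀ {l m} → l ≤ m → A l m ≡ N m l /2^ (m ∸ l)
A≡N/2^[m∸l] {l} {m} l≤m = begin
  fromℕ f * (1 /2^ (2 ℕ.* m) * fromℕ s)
    ≡⟨ cong (fromℕ f *_) (/2^-*-fromℕ 1 s (2 ℕ.* m)) ⟩
  fromℕ f * ((1 ℕ.* s) /2^ (2 ℕ.* m))
    ≡⟨ ℚ.*-comm (fromℕ f) ((1 ℕ.* s) /2^ (2 ℕ.* m)) ⟩
  (1 ℕ.* s) /2^ (2 ℕ.* m) * fromℕ f
    ≡⟨ /2^-*-fromℕ (1 ℕ.* s) f (2 ℕ.* m) ⟩
  (1 ℕ.* s ℕ.* f) /2^ (2 ℕ.* m)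
    ≡⟨ /2^-cross (1 ℕ.* s ℕ.* f) (N m l) (2 ℕ.* m) (m ∸ l) cross ⟩
  N m l /2^ (m ∸ l) ∎
  where
  open ≡-Reasoning
  f = l ! ℕ.* m ! ℕ.* 2 ^ (m + l)
  s = ∑[ l ⋯ m ] (λ k → coeff m k ℕ.* (k C l))
  solve : ∀ a p q s → 1 ℕ.* s ℕ.* (a ℕ.* p) ℕ.* q ≡ a ℕ.* s ℕ.* (p ℕ.* q)
  solve = solve-∀
  exponent : m + l + (m ∸ l) ≡ 2 ℕ.* m
  exponent = begin
    m + l + (m ∸ l)   ≡⟨ +-assoc m l (m ∸ l) ⟩
    m + (l + (m ∸ l)) ≡⟨ cong (λ x → m + x) (trans (m+[n∸m]≡n l≤m) (sym (+-identityʳ m))) ⟩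
    2 ℕ.* m           ∎
  cross : 1 ℕ.* s ℕ.* f ℕ.* 2 ^ (m ∸ l) ≡ N m l ℕ.* 2 ^ (2 ℕ.* m)
  cross = begin
    1 ℕ.* s ℕ.* f ℕ.* 2 ^ (m ∸ l)
      ≡⟨ solve (l ! ℕ.* m !) (2 ^ (m + l)) (2 ^ (m ∸ l)) s ⟩
    l ! ℕ.* m ! ℕ.* s ℕ.* (2 ^ (m + l) ℕ.* 2 ^ (m ∸ l))
      ≡⟨ cong₂ (λ x y → l ! ℕ.* m ! ℕ.* x ℕ.* y) (∑≡S l≤m)
           (trans (sym (^-distribˡ-+-* 2 (m + l) (m ∸ l))) (cong (2 ^_) exponent)) ⟩
    N m l ℕ.* 2 ^ (2 ℕ.* m) ∎

∑-C-symmetric : ∀ l m →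
  ∑[ l ⋯ m ] (λ k → 2 ^ k ℕ.* ((2 ℕ.* m ∸ 2 ℕ.* k) C (m ∸ k)) ℕ.* ((m + k) C k) ℕ.* (k C l))
    ≡ ∑[ l ⋯ m ] (λ k → coeff m k ℕ.* (k C l))
∑-C-symmetric l m = cong sum (map-cong (λ i → symmetric (l + i)) (upTo (suc m ∸ l)))
  where
  symmetric : ∀ k →
    2 ^ k ℕ.* ((2 ℕ.* m ∸ 2 ℕ.* k) C (m ∸ k)) ℕ.* ((m + k) C k) ℕ.* (k C l) ≡ coeff m k ℕ.* (k C l)
  symmetric k = cong (λ x → 2 ^ k ℕ.* ((2 ℕ.* m ∸ 2 ℕ.* k) C (m ∸ k)) ℕ.* x ℕ.* (k C l))
    (trans (nCk≡nC[n∸k] (m≤n+m k m)) (cong ((m + k) C_) (m+n∸n≡m m k)))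

A-formula : ∀ {l m} → l ≤ m → A l m ≡ (l ! ℕ.* m !) /2^ (m ∸ l) * fromℕ
  (∑[ l ⋯ m ] λ k →
    2 ^ k ℕ.* ((2 ℕ.* m ∸ 2 ℕ.* k) C (m ∸ k)) ℕ.* ((m + k) C k) ℕ.* (k C l))
A-formula {l} {m} l≤m =
  trans (A≡N/2^[m∸l] l≤m)
    (trans (sym (/2^-*-fromℕ (l ! ℕ.* m !) (S m (suc m) l) (m ∸ l)))
      (cong (λ x → (l ! ℕ.* m !) /2^ (m ∸ l) * fromℕ x)
        (sym (trans (∑-C-symmetric l m) (∑≡S l≤m)))))

-- Splitting 2^m as 2^l times 2^(m-l) isolates the denominator of `A l m`, leaving 2^l as the extra
-- `l` in the valuation.
N-factored : ∀ {l m} → l ≤ m →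
  ∃[ b ] (¬ 2 ∣ b × N m l ≡ 2 ^ l ℕ.* (pochhammer (m + 1 ∸ l) (2 ℕ.* l) ℕ.* b) ℕ.* 2 ^ (m ∸ l))
N-factored {l} {m} l≤m with (b , 2∤b , eq) , _ ← N-oddMultiple l (m ∸ l) (m+[n∸m]≡n l≤m) =
  b , 2∤b , (begin
    N m l                                   ≡⟨ eq ⟩
    2 ^ m ℕ.* R m l ℕ.* b                   ≡⟨ cong (λ x → x ℕ.* R m l ℕ.* b) 2^m ⟩
    2 ^ l ℕ.* 2 ^ (m ∸ l) ℕ.* R m l ℕ.* b   ≡⟨ solve (2 ^ l) (2 ^ (m ∸ l)) (R m l) b ⟩
    2 ^ l ℕ.* (R m l ℕ.* b) ℕ.* 2 ^ (m ∸ l)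
      ≡⟨ cong (λ x → 2 ^ l ℕ.* (x ℕ.* b) ℕ.* 2 ^ (m ∸ l))
           (R≡pochhammer l (m ∸ l) (m+[n∸m]≡n l≤m)) ⟩
    2 ^ l ℕ.* (pochhammer (m + 1 ∸ l) (2 ℕ.* l) ℕ.* b) ℕ.* 2 ^ (m ∸ l) ∎)
  where
  open ≡-Reasoning
  2^m : 2 ^ m ≡ 2 ^ l ℕ.* 2 ^ (m ∸ l)
  2^m = trans (cong (2 ^_) (sym (m+[n∸m]≡n l≤m))) (^-distribˡ-+-* 2 l (m ∸ l))
  solve : ∀ p q r b → p ℕ.* q ℕ.* r ℕ.* b ≡ p ℕ.* (r ℕ.* b) ℕ.* q
  solve = solve-∀

A-oddMultiple : ∀ {l m} → l ≤ m →
  ∃[ b ] (¬ 2 ∣ b × A l m ≡ fromℕ (2 ^ l ℕ.* (pochhammer (m + 1 ∸ l) (2 ℕ.* l) ℕ.* b)))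
A-oddMultiple {l} {m} l≤m =
  let b , 2∤b , eq = N-factored l≤m
  in b , 2∤b , trans (A≡N/2^[m∸l] l≤m)
       (/2^≡fromℕ (N m l) (2 ^ l ℕ.* (pochhammer (m + 1 ∸ l) (2 ℕ.* l) ℕ.* b)) (m ∸ l) eq)

-- The 2-adic valuation

-- Prime factorisations are unique up to permutation, so the twos may be counted in any convenient
-- one.
ν₂ℕ-factorisation : ∀ {n} .{{_ : NonZero n}} (f : PrimeFactorisation n) →
  ν₂ℕ n ≡ length (filter (2 ℕ.≟_) (factors f))
ν₂ℕ-factorisation {n} f = ↭-length (filter-↭ (2 ℕ.≟_) (factorisationUnique (factorise n) f))

ν₂ℕ-* : ∀ a b .{{_ : NonZero a}} .{{_ : NonZero b}} .{{_ : NonZero (a ℕ.* b)}} →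
  ν₂ℕ (a ℕ.* b) ≡ ν₂ℕ a + ν₂ℕ b
ν₂ℕ-* a b = begin
  ν₂ℕ (a ℕ.* b)
    ≡⟨ ν₂ℕ-factorisation record
         { factors = as ++ bs
         ; isFactorisation = trans
             (cong₂ ℕ._*_ (isFactorisation (factorise a)) (isFactorisation (factorise b)))
             (sym (product-++ as bs))
         ; factorsPrime = All.++⁺ (factorsPrime (factorise a)) (factorsPrime (factorise b))
         } ⟩
  length (filter (2 ℕ.≟_) (as ++ bs))
    ≡⟨ cong length (filter-++ (2 ℕ.≟_) as bs) ⟩
  length (filter (2 ℕ.≟_) as ++ filter (2 ℕ.≟_) bs)
    ≡⟨ length-++ (filter (2 ℕ.≟_) as) ⟩
  ν₂ℕ a + ν₂ℕ b ∎
  where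
  open ≡-Reasoning
  open PrimeFactorisation using (isFactorisation; factorsPrime)
  as = factors (factorise a)
  bs = factors (factorise b)

ν₂ℕ-2^ : ∀ l .{{_ : NonZero (2 ^ l)}} → ν₂ℕ (2 ^ l) ≡ l
ν₂ℕ-2^ zero = refl
ν₂ℕ-2^ (suc l) = trans (ν₂ℕ-* 2 (2 ^ l) {{_}} {{m^n≢0 2 l}})
  (cong₂ _+_ (ν₂ℕ-factorisation (primeFactorisation[p] prime[2])) (ν₂ℕ-2^ l {{m^n≢0 2 l}}))

ν₂ℕ-odd : ∀ n .{{_ : NonZero n}} → ¬ 2 ∣ n → ν₂ℕ n ≡ 0
ν₂ℕ-odd n 2∤n = cong length (filter-none (2 ℕ.≟_) (All.tabulate λ {p} p∈ 2≡p →
  2∤n (subst₂ _∣_ (sym 2≡p) (sym isFactorisation) (∈⇒∣product {ns = factors (factorise n)} p∈))))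
  where open PrimeFactorisation (factorise n) using (isFactorisation)

-- The explicit constructor form is what lets `ν₂` compute.
fromℕ≡mkℚ : ∀ n → fromℕ n ≡ ℚ.mkℚ (+ n) 0 (λ (_ , d∣1) → ∣1⇒≡1 d∣1)
fromℕ≡mkℚ n = ℚ.↥p/↧p≡p (ℚ.mkℚ (+ n) 0 (λ (_ , d∣1) → ∣1⇒≡1 d∣1))

ν₂-fromℕ : ∀ {x} n {{_ : NonZero n}} → x ≡ fromℕ n →
  Σ[ x≢0 ∈ ℚ.NonZero x ] ν₂ x {{x≢0}} ≡ + ν₂ℕ n
-- Matching replaces `x` by the constructor form; its denominator 1 contributes a subtracted 0.
ν₂-fromℕ n {{n≢0}} eq with refl ← trans eq (fromℕ≡mkℚ n) =
  n≢0 , ℤ.+-identityʳ (+ ν₂ℕ n)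

2∤⇒≢0 : ∀ {n} → ¬ 2 ∣ n → NonZero n
2∤⇒≢0 {zero}  2∤0 = contradiction (2 ∣0) 2∤0
2∤⇒≢0 {suc n} _   = _

ν₂ℕ-2^*odd : ∀ l p b .{{_ : NonZero (2 ^ l ℕ.* (p ℕ.* b))}} .{{_ : NonZero p}} →
  ¬ 2 ∣ b → ν₂ℕ (2 ^ l ℕ.* (p ℕ.* b)) ≡ ν₂ℕ p + l
ν₂ℕ-2^*odd l p b 2∤b = begin
  ν₂ℕ (2 ^ l ℕ.* (p ℕ.* b))    ≡⟨ ν₂ℕ-* (2 ^ l) (p ℕ.* b) ⟩
  ν₂ℕ (2 ^ l) + ν₂ℕ (p ℕ.* b)  ≡⟨ cong₂ _+_ (ν₂ℕ-2^ l) (ν₂ℕ-* p b) ⟩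
  l + (ν₂ℕ p + ν₂ℕ b)          ≡⟨ cong (λ x → l + (ν₂ℕ p + x)) (ν₂ℕ-odd b 2∤b) ⟩
  l + (ν₂ℕ p + 0)              ≡⟨ cong (λ x → l + x) (+-identityʳ (ν₂ℕ p)) ⟩
  l + ν₂ℕ p                    ≡⟨ +-comm l (ν₂ℕ p) ⟩
  ν₂ℕ p + l                    ∎
  where
  open ≡-Reasoning
  instance
    b≢0 = 2∤⇒≢0 2∤b
    2^l≢0 = m^n≢0 2 l
    pb≢0 = m*n≢0 p b

ν₂-2^*odd : ∀ {x y} l n p b {{_ : NonZero n}} {{_ : NonZero p}} →
  x ≡ fromℕ n → y ≡ fromℕ p → n ≡ 2 ^ l ℕ.* (p ℕ.* b) → ¬ 2 ∣ b →
  Σ[ x≢0 ∈ ℚ.NonZero x ] Σ[ y≢0 ∈ ℚ.NonZero y ] ν₂ x {{x≢0}} ≡ ν₂ y {{y≢0}} ℤ.+ + l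
ν₂-2^*odd l n p b x≡n y≡p refl 2∤b
  with x≢0 , νx ← ν₂-fromℕ n x≡n | y≢0 , νy ← ν₂-fromℕ p y≡p =
  x≢0 , y≢0 , trans νx (trans (cong +_ (ν₂ℕ-2^*odd l p b 2∤b)) (cong (ℤ._+ + l) (sym νy)))

pochhammer≢0 : ∀ {l m} → l ≤ m → NonZero (pochhammer (m + 1 ∸ l) (2 ℕ.* l))
pochhammer≢0 {l} {m} l≤m =
  subst NonZero (R≡pochhammer l (m ∸ l) (m+[n∸m]≡n l≤m)) (R≢0 l (m ∸ l) (m+[n∸m]≡n l≤m))

2^*odd≢0 : ∀ l p b → NonZero p → ¬ 2 ∣ b → NonZero (2 ^ l ℕ.* (p ℕ.* b))
2^*odd≢0 l p b p≢0 2∤b =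
  m*n≢0 (2 ^ l) (p ℕ.* b) {{m^n≢0 2 l}} {{m*n≢0 p b {{p≢0}} {{2∤⇒≢0 2∤b}}}}

-- Positivity and valuation of A

A-positive : ∀ {l m} → l ≤ m → ∃[ n ] (1 ≤ n × A l m ≡ fromℕ n)
A-positive {l} {m} l≤m =
  let p = pochhammer (m + 1 ∸ l) (2 ℕ.* l)
      b , 2∤b , eq = A-oddMultiple l≤m
  in 2 ^ l ℕ.* (p ℕ.* b) , ℕ.>-nonZero⁻¹ _ {{2^*odd≢0 l p b (pochhammer≢0 l≤m) 2∤b}} , eq

-- Keeping `p` as a variable lets the same lemma serve the rising factorial and, for l = 1, the
-- product m(m+1).
A-valuation : ∀ {l m} p → l ≤ m → p ≡ pochhammer (m + 1 ∸ l) (2 ℕ.* l) →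
  Σ[ A≢0 ∈ ℚ.NonZero (A l m) ] Σ[ P≢0 ∈ ℚ.NonZero (fromℕ p) ]
    ν₂ (A l m) {{A≢0}} ≡ ν₂ (fromℕ p) {{P≢0}} ℤ.+ + l
A-valuation {l} {m} p l≤m refl =
  let b , 2∤b , eq = A-oddMultiple l≤m
  in ν₂-2^*odd {A l m} {fromℕ p} l (2 ^ l ℕ.* (p ℕ.* b)) p b
       {{2^*odd≢0 l p b (pochhammer≢0 l≤m) 2∤b}} {{pochhammer≢0 l≤m}} eq refl refl 2∤b

pochhammer-2 : ∀ m → pochhammer (m + 1 ∸ 1) 2 ≡ m ℕ.* (m + 1)
pochhammer-2 m rewrite m+n∸n≡m m 1 = solve m
  where
  solve : ∀ m → 1 ℕ.* (m + 0) ℕ.* (m + 1) ≡ m ℕ.* (m + 1)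
  solve = solve-∀

mainTheorem9 : (∀ (l m : ℕ) → l ≤ m →
    (A l m ≡ (l ! ℕ.* m !) /2^ (m ∸ l) * fromℕ
    (∑[ l ⋯ m ] λ k →
    2 ^ k ℕ.* ((2 ℕ.* m ∸ 2 ℕ.* k) C (m ∸ k)) ℕ.* ((m + k) C k) ℕ.* (k C l)))
    × (∃[ n ] (1 ≤ n × A l m ≡ fromℕ n))
    × (Σ[ A≢0 ∈ ℚ.NonZero (A l m) ]
    Σ[ P≢0 ∈ ℚ.NonZero (fromℕ (pochhammer (m + 1 ∸ l) (2 ℕ.* l))) ]
    ν₂ (A l m) {{A≢0}}
    ≡ ν₂ (fromℕ (pochhammer (m + 1 ∸ l) (2 ℕ.* l))) {{P≢0}} ℤ.+ + l))
    × (∀ (m : ℕ) → 1 ≤ m →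
    Σ[ A≢0 ∈ ℚ.NonZero (A 1 m) ]
    Σ[ P≢0 ∈ ℚ.NonZero (fromℕ (m ℕ.* (m + 1))) ]
    ν₂ (A 1 m) {{A≢0}} ≡ ν₂ (fromℕ (m ℕ.* (m + 1))) {{P≢0}} ℤ.+ + 1)
mainTheorem9 =
  (λ l m l≤m → A-formula l≤m , A-positive l≤m , A-valuation (pochhammer (m + 1 ∸ l) (2 ℕ.* l)) l≤m refl) ,
  (λ m 1≤m → A-valuation (m ℕ.* (m + 1)) 1≤m (sym (pochhammer-2 m)))
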